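{- For every $\varepsilon>0$ and every integer $s\ge 1$ there exists a $d$-regular $K_{s+2}$-saturated graph on $n$ vertices with $\frac{d}{n}<\varepsilon$. Moreover, for every integer $s\ge1$ there exists an infinite sequence of graphs $F_m$, where $F_m$ is $d_m$-regular, $K_{s+2}$-saturated, has $n_m$ vertices, $n_m\to\infty$, and $\frac{d_m}{n_m}=O_s\!\left(\frac{(\log\log n_m)^2}{\log n_m}\right)$ (the implied constant depending only on $s$).
   Context: All graphs are finite and simple. For a graph $F$, a graph $G$ is $F$-saturated if $G$ contains no copy of $F$, but adding any edge between two non-adjacent vertices of $G$ creates a copy of $F$. $K_{s+2}$ is the complete graph on $s+2$ vertices. -}

module Defs where

open import Data.Nat using (ℕ; _+_; _*_; _≤_; _<_; _^_)
open import Data.Nat.Logarithm using (⌊log₂_⌋)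
open import Data.Bool using (Bool; true; false; _∨_; _∧_; if_then_else_)
open import Data.Fin using (Fin; _≟_)
open import Data.List using (map; allFin)
open import Data.Nat.ListAction using (sum)
open import Data.Product using (Σ; _×_; ∃-syntax)
open import Relation.Binary.PropositionalEquality using (_≡_; _≢_)
open import Relation.Nullary using (¬_)
open import Relation.Nullary.Decidable using (⌊_⌋)
open import Function.Definitions using (Injective)

record Graph (n : ℕ) : Set where
  field
    adj    : Fin n → Fin n → Bool
    sym    : ∀ u v → adj u v ≡ adj v u
    irrefl : ∀ v → adj v v ≡ false
open Graph public

addEdgeAdj : ∀ {n} → (Fin n → Fin n → Bool) → Fin n → Fin n → Fin n → Fin n → Bool
addEdgeAdj a u v x y =
  a x y ∨ ((⌊ x ≟ u ⌋ ∧ ⌊ y ≟ v ⌋) ∨ (⌊ x ≟ v ⌋ ∧ ⌊ y ≟ u ⌋))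

HasClique : ∀ {n} → ℕ → (Fin n → Fin n → Bool) → Set
HasClique {n} k a =
  Σ (Fin k → Fin n) λ f → Injective _≡_ _≡_ f × (∀ i j → i ≢ j → a (f i) (f j) ≡ true)

Saturated : ∀ {n} → ℕ → Graph n → Set
Saturated k G =
  ¬ HasClique k (adj G) ×
  (∀ u v → u ≢ v → adj G u v ≡ false → HasClique k (addEdgeAdj (adj G) u v))

degree : ∀ {n} → Graph n → Fin n → ℕ
degree {n} G u = sum (map (λ v → if adj G u v then 1 else 0) (allFin n))

Regular : ∀ {n} → ℕ → Graph n → Set
Regular d G = ∀ u → degree G u ≡ d

{-# OPTIONS --safe #-}
-- The vertices are the quadruples (b , x ; a , y) with b, a ∈ Fin q and x, y ∈ Fin (s + 1); two of
-- them are adjacent when b = b′ or a = a′, where b = b′ forces x ≠ x′ and a = a′ forces y ≠ y′.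
-- By pigeonhole a clique on s + 2 vertices contains two vertices with equal x, hence distinct b,
-- and two vertices v, w with equal y, hence distinct a and a common b.  One vertex of the first pair
-- has a different b, so it shares its a with both v and w, a contradiction.
-- Any two non-adjacent vertices have s pairwise adjacent common neighbours within a single
-- class (b , a), where distinct x together with distinct y already give adjacency.
-- The graph is regular on n = (q (s + 1))² vertices, and its degree is at most 2 n / q, which
-- is far below the required density bound.
module Submission where

open import Defs
open import Data.Nat using (ℕ; zero; suc; _+_; _*_; _≤_; _<_; _^_; z≤n; s≤s; z<s)
open import Data.Nat.Logarithm using (⌊log₂_⌋; ⌊log₂⌋-mono-≤; ⌊log₂[2^n]⌋≡n)
open import Data.Nat.Properties hiding (_≟_; <⇒≢)
open import Data.Nat.Tactic.RingSolver using (solve-∀)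
open import Data.Bool using (Bool; true; false; _∨_; _∧_; not; if_then_else_)
open import Data.Bool.Properties using (∨-zeroʳ)
open import Data.Fin using (Fin; zero; suc; _≟_; combine; remQuot; _↑ˡ_; _↑ʳ_; punchIn)
open import Data.Fin.Properties
  using (remQuot-combine; pigeonhole; punchInᵢ≢i; punchIn-injective; <⇒≢)
open import Data.List using (tabulate; map; allFin)
open import Data.List.Properties using (map-tabulate)
import Data.Nat.ListAction as List
open import Data.Product using (Σ; _×_; ∃-syntax; _,_; proj₁; proj₂)
import Data.Product as Prod
open import Data.Sum using (_⊎_; inj₁; inj₂)
import Data.Sum as Sum
open import Function using (_∘_; mk⇔)
open import Relation.Binary.PropositionalEquality as ≡
  using (_≡_; _≢_; refl; cong; cong₂; subst; subst₂; ≢-sym)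
open import Relation.Nullary using (¬_; Dec; yes; no; does; contradiction)
open import Relation.Nullary.Decidable
  using (⌊_⌋; dec-true; dec-false; does-⇔; ¬?; _×-dec_; _⊎-dec_; _→-dec_)
open import Algebra.Properties.Semiring.Sum +-*-semiring
  using (sum; sum-syntax; sum-cong-≗; ∑-distrib-+; *-distribˡ-sum; *-distribʳ-sum)

-- Finite sums of indicators and of products.

𝟙 : Bool → ℕ
𝟙 b = if b then 1 else 0

sum-tabulate : ∀ {n} (f : Fin n → ℕ) → List.sum (tabulate f) ≡ sum f
sum-tabulate {zero}  f = refl
sum-tabulate {suc n} f = cong (f zero +_) (sum-tabulate (f ∘ suc))

sum-1 : ∀ n → ∑[ i < n ] 1 ≡ n
sum-1 zero    = refl
sum-1 (suc n) = cong suc (sum-1 n)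

sum-0 : ∀ n → ∑[ i < n ] 0 ≡ 0
sum-0 zero    = refl
sum-0 (suc n) = sum-0 n

sum-≟ : ∀ {n} (i : Fin n) → ∑[ j < n ] 𝟙 (does (i ≟ j)) ≡ 1
sum-≟ {suc n} zero    = cong suc (sum-0 n)
sum-≟ {suc n} (suc i) = sum-≟ i

sum-≢ : ∀ {n} (i : Fin (suc n)) → ∑[ j < suc n ] 𝟙 (not (does (i ≟ j))) ≡ n
sum-≢ {n}     zero    = sum-1 n
sum-≢ {suc n} (suc i) = cong suc (sum-≢ i)

sum-splitAt : ∀ k {n} (f : Fin (k + n) → ℕ) →
  sum f ≡ ∑[ j < k ] f (j ↑ˡ n) + ∑[ i < n ] f (k ↑ʳ i)
sum-splitAt zero    f = refl
sum-splitAt (suc k) f =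
  ≡.trans (cong (f zero +_) (sum-splitAt k (f ∘ suc))) (≡.sym (+-assoc (f zero) _ _))

sum-combine : ∀ m k (f : Fin (m * k) → ℕ) → sum f ≡ ∑[ i < m ] ∑[ j < k ] f (combine i j)
sum-combine zero    k f = refl
sum-combine (suc m) k f =
  ≡.trans (sum-splitAt k f) (cong (∑[ j < k ] f (j ↑ˡ m * k) +_) (sum-combine m k (f ∘ (k ↑ʳ_))))

sum-remQuot : ∀ m k (f : Fin m × Fin k → ℕ) →
  ∑[ i < m * k ] f (remQuot k i) ≡ ∑[ i < m ] ∑[ j < k ] f (i , j)
sum-remQuot m k f = ≡.trans (sum-combine m k (f ∘ remQuot k))
  (sum-cong-≗ λ i → sum-cong-≗ λ j → cong f (remQuot-combine i j))

sum-* : ∀ {m k} (f : Fin m → ℕ) (g : Fin k → ℕ) →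
  ∑[ i < m ] ∑[ j < k ] (f i * g j) ≡ sum f * sum g
sum-* f g = ≡.trans
  (sum-cong-≗ λ i → ≡.sym (*-distribˡ-sum (f i) g))
  (≡.sym (*-distribʳ-sum (sum g) f))

-- Cliques, and cliques created by an added edge.

does⇒ : ∀ {A : Set} (a? : Dec A) → does a? ≡ true → A
does⇒ (yes a) _ = a

does-false⇒¬ : ∀ {A : Set} (a? : Dec A) → does a? ≡ false → ¬ A
does-false⇒¬ (no ¬a) _ = ¬a

-- Injectivity comes for free: a collision of two distinct indices would be a loop.
mkClique : ∀ {n k} {a : Fin n → Fin n → Bool} → (∀ v → a v v ≡ false) →
  (f : Fin k → Fin n) → (∀ i j → i ≢ j → a (f i) (f j) ≡ true) → HasClique k a
mkClique {a = a} a-irrefl f joined = f , f-injective , joined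
  where
  f-injective : ∀ {i j} → f i ≡ f j → i ≡ j
  f-injective {i} {j} fi≡fj with i ≟ j
  ... | yes i≡j = i≡j
  ... | no  i≢j = contradiction
    (≡.trans (≡.sym (joined i j i≢j)) (≡.trans (cong (a (f i)) (≡.sym fi≡fj)) (a-irrefl (f i))))
    λ ()

module _ {n} (G : Graph n) {u v : Fin n} where

  private
    G+uv : Fin n → Fin n → Bool
    G+uv = addEdgeAdj (adj G) u v

  addEdge-⊇ : ∀ {x y} → adj G x y ≡ true → G+uv x y ≡ true
  addEdge-⊇ e rewrite e = refl

  addEdge-uv : G+uv u v ≡ true
  addEdge-uv with u ≟ u | v ≟ v
  ... | yes _   | yes _   = ∨-zeroʳ (adj G u v)
  ... | no  u≢u | _       = contradiction refl u≢u
  ... | yes _   | no  v≢v = contradiction refl v≢v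

  addEdge-vu : G+uv v u ≡ true
  addEdge-vu with u ≟ u | v ≟ v
  ... | no  u≢u | _       = contradiction refl u≢u
  ... | yes _   | no  v≢v = contradiction refl v≢v
  ... | yes _   | yes _
    rewrite ∨-zeroʳ (⌊ v ≟ u ⌋ ∧ ⌊ u ≟ v ⌋) = ∨-zeroʳ (adj G v u)

  addEdge-irrefl : u ≢ v → ∀ x → G+uv x x ≡ false
  addEdge-irrefl u≢v x rewrite irrefl G x with x ≟ u | x ≟ v
  ... | yes refl | yes refl = contradiction refl u≢v
  ... | yes _    | no  _    = refl
  ... | no  _    | yes _    = refl
  ... | no  _    | no  _    = refl

  -- Reduces saturation to a search for cliques among common neighbours: `u v` is the only new edge
  -- that the enlarged clique uses.
  common-clique⇒clique : ∀ {k} → u ≢ v → (t : Fin k → Fin n) →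
    (∀ i j → i ≢ j → adj G (t i) (t j) ≡ true) →
    (∀ i → adj G u (t i) ≡ true) → (∀ i → adj G v (t i) ≡ true) →
    HasClique (2 + k) G+uv
  common-clique⇒clique {k} u≢v t tt ut vt = mkClique {a = G+uv} (addEdge-irrefl u≢v) f joined
    where
    f : Fin (2 + k) → Fin n
    f zero          = u
    f (suc zero)    = v
    f (suc (suc i)) = t i

    flip : ∀ {x y} → adj G x y ≡ true → adj G y x ≡ true
    flip {x} {y} = ≡.trans (sym G y x)

    joined : ∀ i j → i ≢ j → G+uv (f i) (f j) ≡ true
    joined zero          zero          i≢j = contradiction refl i≢j
    joined zero          (suc zero)    _   = addEdge-uv
    joined zero          (suc (suc j)) _   = addEdge-⊇ (ut j)
    joined (suc zero)    zero          _   = addEdge-vu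
    joined (suc zero)    (suc zero)    i≢j = contradiction refl i≢j
    joined (suc zero)    (suc (suc j)) _   = addEdge-⊇ (vt j)
    joined (suc (suc i)) zero          _   = addEdge-⊇ (flip (ut i))
    joined (suc (suc i)) (suc zero)    _   = addEdge-⊇ (flip (vt i))
    joined (suc (suc i)) (suc (suc j)) i≢j = addEdge-⊇ (tt i j λ i≡j → i≢j (cong (2 ↑ʳ_) i≡j))

-- The graph on quadruples.

module Construction (r s : ℕ) where

  -- `p` is one less than the forbidden clique size, so pigeonhole applies, and omitting one value
  -- still leaves `s`. `q` is at least 2, so a value of `b` or `a` can always be avoided.
  p q t n : ℕ
  p = suc s
  q = suc (suc r)
  t = q * p
  n = t * t

  Half Quad : Set
  Half = Fin q × Fin p
  Quad = Half × Half

  decode : Fin n → Quad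
  decode = Prod.map (remQuot p) (remQuot p) ∘ remQuot t

  encode : Quad → Fin n
  encode ((b , x) , (a , y)) = combine (combine b x) (combine a y)

  decode-encode : ∀ w → decode (encode w) ≡ w
  decode-encode ((b , x) , (a , y)) = ≡.trans
    (cong (Prod.map (remQuot p) (remQuot p)) (remQuot-combine (combine b x) (combine a y)))
    (cong₂ _,_ (remQuot-combine b x) (remQuot-combine a y))

  Adj : Quad → Quad → Set
  Adj ((b , x) , (a , y)) ((b′ , x′) , (a′ , y′)) =
    (b ≡ b′ ⊎ a ≡ a′) × (b ≡ b′ → x ≢ x′) × (a ≡ a′ → y ≢ y′)

  adj? : ∀ v w → Dec (Adj v w)
  adj? ((b , x) , (a , y)) ((b′ , x′) , (a′ , y′)) =
    (b ≟ b′ ⊎-dec a ≟ a′) ×-dec (b ≟ b′ →-dec ¬? (x ≟ x′)) ×-dec (a ≟ a′ →-dec ¬? (y ≟ y′))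

  Adj-sym : ∀ {v w} → Adj v w → Adj w v
  Adj-sym (e , f , g) =
    Sum.map ≡.sym ≡.sym e , (λ e → ≢-sym (f (≡.sym e))) , (λ e → ≢-sym (g (≡.sym e)))

  Adj-irrefl : ∀ v → ¬ Adj v v
  Adj-irrefl v (_ , f , _) = f refl refl

  G : Graph n
  G .adj u v  = does (adj? (decode u) (decode v))
  G .sym u v  = does-⇔ (mk⇔ Adj-sym Adj-sym) (adj? (decode u) (decode v)) (adj? (decode v) (decode u))
  G .irrefl v = dec-false (adj? (decode v) (decode v)) (Adj-irrefl (decode v))

  -- Degree count.

  near far : Half → Half → ℕ
  near (b , x) (b′ , x′) = 𝟙 (does (b ≟ b′)) * 𝟙 (not (does (x ≟ x′)))
  -- The factor `1` leaves `x′` free and keeps the product shape required by `sum-*`.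
  far  (b , x) (b′ , x′) = 𝟙 (not (does (b ≟ b′))) * 1

  ∑near : ∀ h → ∑[ i < t ] near h (remQuot p i) ≡ s
  ∑near (b , x) = begin
    ∑[ i < t ] near (b , x) (remQuot p i)                             ≡⟨ sum-remQuot q p (near (b , x)) ⟩
    ∑[ b′ < q ] ∑[ x′ < p ] near (b , x) (b′ , x′)                    ≡⟨ sum-* (λ b′ → 𝟙 (does (b ≟ b′))) (λ x′ → 𝟙 (not (does (x ≟ x′)))) ⟩
    ∑[ b′ < q ] 𝟙 (does (b ≟ b′)) * ∑[ x′ < p ] 𝟙 (not (does (x ≟ x′))) ≡⟨ cong₂ _*_ (sum-≟ b) (sum-≢ x) ⟩
    1 * s                                                             ≡⟨ *-identityˡ s ⟩
    s                                                                 ∎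
    where open ≡.≡-Reasoning

  ∑far : ∀ h → ∑[ i < t ] far h (remQuot p i) ≡ suc r * p
  ∑far (b , x) = begin
    ∑[ i < t ] far (b , x) (remQuot p i)                   ≡⟨ sum-remQuot q p (far (b , x)) ⟩
    ∑[ b′ < q ] ∑[ x′ < p ] far (b , x) (b′ , x′)          ≡⟨ sum-* (λ b′ → 𝟙 (not (does (b ≟ b′)))) (λ (_ : Fin p) → 1) ⟩
    ∑[ b′ < q ] 𝟙 (not (does (b ≟ b′))) * ∑[ x′ < p ] 1    ≡⟨ cong₂ _*_ (sum-≢ b) (sum-1 p) ⟩
    suc r * p                                              ∎
    where open ≡.≡-Reasoning

  -- Adjacency splits into three disjoint cases, according to which of `b`, `a` agree; at least one
  -- must. Each case is a product over the two halves, so its double sum factors.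
  𝟙-adj : ∀ h k h′ k′ → 𝟙 (does (adj? (h , k) (h′ , k′))) ≡
    near h h′ * near k k′ + (near h h′ * far k k′ + far h h′ * near k k′)
  𝟙-adj (b , x) (a , y) (b′ , x′) (a′ , y′) =
    -- `does` of the combined decision computes to Boolean operations, which leaves a truth table.
    bools (does (b ≟ b′)) (does (a ≟ a′)) (does (x ≟ x′)) (does (y ≟ y′))
    where
    bools : ∀ e₁ e₂ c₁ c₂ → 𝟙 ((e₁ ∨ e₂) ∧ (not e₁ ∨ not c₁) ∧ (not e₂ ∨ not c₂)) ≡
      𝟙 e₁ * 𝟙 (not c₁) * (𝟙 e₂ * 𝟙 (not c₂)) +
      (𝟙 e₁ * 𝟙 (not c₁) * (𝟙 (not e₂) * 1) + 𝟙 (not e₁) * 1 * (𝟙 e₂ * 𝟙 (not c₂)))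
    bools true  true  true  true  = refl
    bools true  true  true  false = refl
    bools true  true  false true  = refl
    bools true  true  false false = refl
    bools true  false true  _     = refl
    bools true  false false _     = refl
    bools false true  _     true  = refl
    bools false true  _     false = refl
    bools false false _     _     = refl

  d : ℕ
  d = s * s + (s * (suc r * p) + suc r * p * s)

  ∑∑-* : (f g : Half → ℕ) →
    ∑[ i < t ] ∑[ j < t ] (f (remQuot p i) * g (remQuot p j)) ≡
    ∑[ i < t ] f (remQuot p i) * ∑[ j < t ] g (remQuot p j)
  ∑∑-* f g = sum-* (f ∘ remQuot p) (g ∘ remQuot p)

  regular : Regular d G
  regular u = begin
    List.sum (map (λ v → 𝟙 (adj G u v)) (allFin n))
      ≡⟨ cong List.sum (map-tabulate (λ v → v) (λ v → 𝟙 (adj G u v))) ⟩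
    List.sum (tabulate (λ v → 𝟙 (adj G u v)))
      ≡⟨ sum-tabulate (λ v → 𝟙 (adj G u v)) ⟩
    ∑[ v < n ] 𝟙 (adj G u v)
      ≡⟨ sum-remQuot t t (λ w → 𝟙 (does (adj? (h , k) (Prod.map (remQuot p) (remQuot p) w)))) ⟩
    ∑[ i < t ] ∑[ j < t ] 𝟙 (does (adj? (h , k) (remQuot p i , remQuot p j)))
      ≡⟨ sum-cong-≗ {t} (λ i → sum-cong-≗ {t} λ j → 𝟙-adj h k (remQuot p i) (remQuot p j)) ⟩
    ∑[ i < t ] ∑[ j < t ] (NN i j + (NF i j + FN i j))
      ≡⟨ sum-cong-≗ {t} (λ i → ≡.trans (∑-distrib-+ (NN i) (λ j → NF i j + FN i j))
           (cong (sum (NN i) +_) (∑-distrib-+ (NF i) (FN i)))) ⟩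
    ∑[ i < t ] (sum (NN i) + (sum (NF i) + sum (FN i)))
      ≡⟨ ≡.trans (∑-distrib-+ (sum ∘ NN) (λ i → sum (NF i) + sum (FN i)))
           (cong (sum (sum ∘ NN) +_) (∑-distrib-+ (sum ∘ NF) (sum ∘ FN))) ⟩
    sum (sum ∘ NN) + (sum (sum ∘ NF) + sum (sum ∘ FN))
      ≡⟨ cong₂ _+_ (∑∑-* (near h) (near k)) (cong₂ _+_ (∑∑-* (near h) (far k)) (∑∑-* (far h) (near k))) ⟩
    ∑h near * ∑k near + (∑h near * ∑k far + ∑h far * ∑k near)
      ≡⟨ cong₂ _+_ (cong₂ _*_ (∑near h) (∑near k))
           (cong₂ _+_ (cong₂ _*_ (∑near h) (∑far k)) (cong₂ _*_ (∑far h) (∑near k))) ⟩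
    d ∎
    where
    open ≡.≡-Reasoning
    h k : Half
    h = proj₁ (decode u)
    k = proj₂ (decode u)
    ∑h ∑k : (Half → Half → ℕ) → ℕ
    ∑h f = ∑[ i < t ] f h (remQuot p i)
    ∑k f = ∑[ j < t ] f k (remQuot p j)
    NN NF FN : Fin t → Fin t → ℕ
    NN i j = near h (remQuot p i) * near k (remQuot p j)
    NF i j = near h (remQuot p i) * far  k (remQuot p j)
    FN i j = far  h (remQuot p i) * near k (remQuot p j)

  -- Absence of large cliques.

  ¬clique : ¬ HasClique (2 + s) (adj G)
  ¬clique (f , _ , joined)
    with pigeonhole (n<1+n p) (proj₂ ∘ proj₁ ∘ decode ∘ f)
       | pigeonhole (n<1+n p) (proj₂ ∘ proj₂ ∘ decode ∘ f)
  ... | i , j , i<j , xᵢ≡xⱼ | k , l , k<l , yₖ≡yₗ = absurd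
    where
    b a : Fin (2 + s) → Fin q
    b = proj₁ ∘ proj₁ ∘ decode ∘ f
    a = proj₁ ∘ proj₂ ∘ decode ∘ f

    joined′ : ∀ {i j} → i ≢ j → Adj (decode (f i)) (decode (f j))
    joined′ {i} {j} i≢j = does⇒ (adj? _ _) (joined i j i≢j)

    bᵢ≢bⱼ : b i ≢ b j
    bᵢ≢bⱼ e = proj₁ (proj₂ (joined′ (<⇒≢ i<j))) e xᵢ≡xⱼ

    aₖ≢aₗ : a k ≢ a l
    aₖ≢aₗ e = proj₂ (proj₂ (joined′ (<⇒≢ k<l))) e yₖ≡yₗ

    b≢⇒a≡ : ∀ {i j} → b i ≢ b j → a i ≡ a j
    b≢⇒a≡ bi≢bj with proj₁ (joined′ (bi≢bj ∘ cong b))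
    ... | inj₁ e = contradiction e bi≢bj
    ... | inj₂ e = e

    bₖ≡bₗ : b k ≡ b l
    bₖ≡bₗ with proj₁ (joined′ (<⇒≢ k<l))
    ... | inj₁ e = e
    ... | inj₂ e = contradiction e aₖ≢aₗ

    -- If `b m` differed from the common value `b k ≡ b l`, then `a m` would equal both `a k` and
    -- `a l`, which are distinct. Applied to `i` and `j`, this contradicts `bᵢ≢bⱼ`.
    b-≡bₖ : ∀ m → b m ≡ b k
    b-≡bₖ m with b m ≟ b k
    ... | yes e = e
    ... | no ne = contradiction
      (≡.trans (≡.sym (b≢⇒a≡ ne)) (b≢⇒a≡ (λ e → ne (≡.trans e (≡.sym bₖ≡bₗ))))) aₖ≢aₗ

    absurd = bᵢ≢bⱼ (≡.trans (b-≡bₖ i) (≡.sym (b-≡bₖ j)))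

  -- Saturation.

  cell : Fin q → Fin p → Fin q → Fin p → Fin s → Quad
  cell b x a y i = (b , punchIn x i) , (a , punchIn y i)

  cell-clique : ∀ b x a y i j → i ≢ j → Adj (cell b x a y i) (cell b x a y j)
  cell-clique b x a y i j i≢j =
    inj₁ refl , (λ _ → i≢j ∘ punchIn-injective x i j) , (λ _ → i≢j ∘ punchIn-injective y i j)

  -- Non-adjacency has three causes: no shared class, a shared `b` with equal `x`, or a shared `a`
  -- with equal `y`. In a cell, `punchIn x` and `punchIn y` run over the values other than `x` and
  -- `y`.
  saturating-cell : ∀ v w → ¬ Adj v w → ∃[ b ] ∃[ x ] ∃[ a ] ∃[ y ]
    (∀ i → Adj v (cell b x a y i)) × (∀ i → Adj w (cell b x a y i))
  saturating-cell ((b , x) , (a , y)) ((b′ , x′) , (a′ , y′)) ¬adj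
    with b ≟ b′ | a ≟ a′ | x ≟ x′ | y ≟ y′
  -- The cell shares only `b` with the first vertex and only `a′` with the second, so each imposes a
  -- single omitted value.
  ... | no b≢b′ | no a≢a′ | _ | _ = b , x , a′ , y′ ,
        (λ i → inj₁ refl , (λ _ → ≢-sym (punchInᵢ≢i x i)) , λ a≡a′ → contradiction a≡a′ a≢a′) ,
        (λ i → inj₂ refl , (λ b′≡b → contradiction (≡.sym b′≡b) b≢b′) , λ _ → ≢-sym (punchInᵢ≢i y′ i))
  -- Both vertices share `b` and `x`, so omitting `x` serves both. The new `a` differs from `a′` but
  -- may equal `a`, hence `y` is omitted as well. The next case is the mirror image.
  ... | yes refl | _ | yes refl | _ = b , x , punchIn a′ zero , y ,
        (λ i → inj₁ refl , (λ _ → ≢-sym (punchInᵢ≢i x i)) , λ _ → ≢-sym (punchInᵢ≢i y i)) ,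
        (λ i → inj₁ refl , (λ _ → ≢-sym (punchInᵢ≢i x i)) , λ e → contradiction (≡.sym e) (punchInᵢ≢i a′ zero))
  ... | _ | yes refl | _ | yes refl = punchIn b′ zero , x , a , y ,
        (λ i → inj₂ refl , (λ _ → ≢-sym (punchInᵢ≢i x i)) , λ _ → ≢-sym (punchInᵢ≢i y i)) ,
        (λ i → inj₂ refl , (λ e → contradiction (≡.sym e) (punchInᵢ≢i b′ zero)) , λ _ → ≢-sym (punchInᵢ≢i y i))
  -- In all remaining cases the two vertices are adjacent.
  ... | yes b≡b′ | no a≢a′ | no x≢x′ | _ =
        contradiction (inj₁ b≡b′ , (λ _ → x≢x′) , λ a≡a′ → contradiction a≡a′ a≢a′) ¬adj
  ... | no b≢b′ | yes a≡a′ | _ | no y≢y′ =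
        contradiction (inj₂ a≡a′ , (λ b≡b′ → contradiction b≡b′ b≢b′) , λ _ → y≢y′) ¬adj
  ... | yes b≡b′ | yes a≡a′ | no x≢x′ | no y≢y′ =
        contradiction (inj₁ b≡b′ , (λ _ → x≢x′) , λ _ → y≢y′) ¬adj

  saturating : ∀ u v → u ≢ v → adj G u v ≡ false → HasClique (2 + s) (addEdgeAdj (adj G) u v)
  saturating u v u≢v uv≡false
    with saturating-cell (decode u) (decode v) (does-false⇒¬ (adj? (decode u) (decode v)) uv≡false)
  ... | b , x , a , y , uc , vc = common-clique⇒clique G u≢v (encode ∘ c)
    (λ i j i≢j → dec-true (adj? _ _)
      (subst₂ Adj (≡.sym (decode-encode (c i))) (≡.sym (decode-encode (c j))) (cell-clique b x a y i j i≢j)))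
    (λ i → dec-true (adj? _ _) (subst (Adj (decode u)) (≡.sym (decode-encode (c i))) (uc i)))
    (λ i → dec-true (adj? _ _) (subst (Adj (decode v)) (≡.sym (decode-encode (c i))) (vc i)))
    where c = cell b x a y

  saturated : Saturated (s + 2) G
  saturated = subst (λ k → Saturated k G) (+-comm 2 s) (¬clique , saturating)

  -- Density and logarithm estimates.

  d≤2tp : d ≤ 2 * (t * p)
  d≤2tp = begin
    s * s + (s * F + F * s)  ≡⟨ factor s F ⟩
    -- `p + F` unfolds to `t`. As `n` is `t * t` and `t` is `q * p`, the resulting density is at
    -- most `2 / q`.
    s * (s + F) + s * F      ≤⟨ +-mono-≤ (*-mono-≤ s≤p (+-monoˡ-≤ F s≤p)) (*-mono-≤ s≤p (m≤n+m F p)) ⟩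
    p * t + p * t            ≡⟨ double p t ⟩
    2 * (t * p)              ∎
    where
    open ≤-Reasoning
    F : ℕ
    F = suc r * p
    s≤p : s ≤ p
    s≤p = n≤1+n s
    factor : ∀ s F → s * s + (s * F + F * s) ≡ s * (s + F) + s * F
    factor = solve-∀
    double : ∀ p t → p * t + p * t ≡ 2 * (t * p)
    double = solve-∀

  q≤t : q ≤ t
  q≤t = m≤m*n q p

  q≤n : q ≤ n
  q≤n = ≤-trans q≤t (m≤m*n t t)

n≤2^n : ∀ n → n ≤ 2 ^ n
n≤2^n zero    = z≤n
n≤2^n (suc n) = ≤-trans (+-mono-≤ (m^n>0 2 n) (n≤2^n n)) (+-monoʳ-≤ (2 ^ n) (m≤m+n (2 ^ n) 0))

-- This crude bound suffices: the density decays like `1 / t`, so multiplying by a quantity linear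
-- in `t` keeps it bounded for fixed `s`.
⌊log₂[n*n]⌋≤2n : ∀ n → ⌊log₂ (n * n) ⌋ ≤ 2 * n
⌊log₂[n*n]⌋≤2n n = begin
  ⌊log₂ (n * n) ⌋          ≤⟨ ⌊log₂⌋-mono-≤ (*-mono-≤ (n≤2^n n) (n≤2^n n)) ⟩
  ⌊log₂ (2 ^ n * 2 ^ n) ⌋  ≡⟨ cong ⌊log₂_⌋ (^-distribˡ-+-* 2 n n) ⟨
  ⌊log₂ (2 ^ (n + n)) ⌋    ≡⟨ ⌊log₂[2^n]⌋≡n (n + n) ⟩
  n + n                    ≡⟨ cong (n +_) (+-identityʳ n) ⟨
  2 * n                    ∎
  where open ≤-Reasoning

loglog≥1 : ∀ {n} → 4 ≤ n → 1 ≤ ⌊log₂ ⌊log₂ n ⌋ ⌋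
loglog≥1 4≤n = ⌊log₂⌋-mono-≤ {2} (⌊log₂⌋-mono-≤ {4} 4≤n)

-- Choice of parameters for the two density claims.

theorem1p3 : ((a b : ℕ) → 0 < a → 0 < b → (s : ℕ) → 1 ≤ s →
    ∃[ n ] ∃[ d ] Σ (Graph n) λ G →
    Regular d G × Saturated (s + 2) G × d * b < a * n)
    ×
    ((s : ℕ) → 1 ≤ s →
    Σ (ℕ → ℕ) λ nm → Σ (ℕ → ℕ) λ dm → Σ ((m : ℕ) → Graph (nm m)) λ F →
    (∀ m → Regular (dm m) (F m) × Saturated (s + 2) (F m))
    × (∀ N → ∃[ M ] (∀ m → M ≤ m → N ≤ nm m))
    × (∃[ C ] ∃[ M ] (∀ m → M ≤ m →
    dm m * ⌊log₂ (nm m) ⌋ ≤ C * (⌊log₂ ⌊log₂ (nm m) ⌋ ⌋ ^ 2) * nm m)))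
theorem1p3 = sparse , sequence
  where
  open ≤-Reasoning

  sparse : (a b : ℕ) → 0 < a → 0 < b → (s : ℕ) → 1 ≤ s →
    ∃[ n ] ∃[ d ] Σ (Graph n) λ G → Regular d G × Saturated (s + 2) G × d * b < a * n
  sparse a b 0<a _ s _ = n , d , G , regular , saturated , (begin-strict
    d * b              ≤⟨ *-monoˡ-≤ b d≤2tp ⟩
    2 * (t * p) * b    ≡⟨ regroup t p b ⟩
    -- The choice `r = 2 * b` makes `q` equal to `2 + 2 * b`, so `2 / q` is below `1 / b`, hence
    -- below `a / b`.
    t * p * (2 * b)    <⟨ *-monoʳ-< (t * p) (m<n+m (2 * b) {2} z<s) ⟩
    t * p * q          ≡⟨ *-assoc t p q ⟩
    t * (p * q)        ≡⟨ cong (t *_) (*-comm p q) ⟩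
    n                  ≡⟨ *-identityˡ n ⟨
    1 * n              ≤⟨ *-monoˡ-≤ n 0<a ⟩
    a * n              ∎)
    where
    open Construction (2 * b) s
    regroup : ∀ t p b → 2 * (t * p) * b ≡ t * p * (2 * b)
    regroup = solve-∀

  sequence : (s : ℕ) → 1 ≤ s →
    Σ (ℕ → ℕ) λ nm → Σ (ℕ → ℕ) λ dm → Σ ((m : ℕ) → Graph (nm m)) λ F →
    (∀ m → Regular (dm m) (F m) × Saturated (s + 2) (F m))
    × (∀ N → ∃[ M ] (∀ m → M ≤ m → N ≤ nm m))
    × (∃[ C ] ∃[ M ] (∀ m → M ≤ m →
    dm m * ⌊log₂ (nm m) ⌋ ≤ C * (⌊log₂ ⌊log₂ (nm m) ⌋ ⌋ ^ 2) * nm m))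
  sequence s _ = (λ m → n m s) , (λ m → d m s) , (λ m → G m s) ,
    (λ m → regular m s , saturated m s) ,
    (λ N → N , λ m N≤m → ≤-trans N≤m (≤-trans (m≤n+m m 2) (q≤n m s))) ,
    -- The constant collects 2 from the degree bound, 2 from the logarithm bound, and `p`. The
    -- threshold is 0 because `n` is always at least 4.
    4 * suc s , 0 , λ m _ → bound m
    where
    open Construction
    regroup : ∀ t p → 2 * (t * p) * (2 * t) ≡ 4 * p * 1 * (t * t)
    regroup = solve-∀
    bound : ∀ m → d m s * ⌊log₂ n m s ⌋ ≤ 4 * suc s * (⌊log₂ ⌊log₂ n m s ⌋ ⌋ ^ 2) * n m s
    bound m = begin
      d m s * ⌊log₂ n m s ⌋                    ≤⟨ *-mono-≤ (d≤2tp m s) (⌊log₂[n*n]⌋≤2n (t m s)) ⟩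
      2 * (t m s * suc s) * (2 * t m s)        ≡⟨ regroup (t m s) (suc s) ⟩
      -- The factor `1` is read as `1 ^ 2` and enlarged to the squared iterated logarithm.
      4 * suc s * 1 * n m s                    ≤⟨ *-monoˡ-≤ (n m s) (*-monoʳ-≤ (4 * suc s) (^-monoˡ-≤ 2 (loglog≥1 4≤n))) ⟩
      4 * suc s * (⌊log₂ ⌊log₂ n m s ⌋ ⌋ ^ 2) * n m s  ∎
      where
      2≤t : 2 ≤ t m s
      2≤t = ≤-trans (s≤s (s≤s z≤n)) (q≤t m s)
      4≤n : 4 ≤ n m s
      4≤n = *-mono-≤ 2≤t 2≤t
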